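{- Let $r \in \mathbb{Z}_{\geqslant 2}$. For any real number $x \geqslant 1$, $$\sum_{n_1 \leqslant x, \dotsc, n_r \leqslant x} \left( \mu \left( n_1 \right) + \dotsb + \mu \left( n_r \right) \right) \left \lfloor \frac{x}{n_1 \dotsb n_r} \right \rfloor = r \sum_{n \leqslant x} \tau_{r-1}(n),$$ where the sum on the left runs over all $r$-tuples of positive integers $n_1,\dots,n_r \leqslant x$.
   Context: $\mu$ is the Möbius function, $\lfloor \cdot \rfloor$ the integer part, and $\tau_k(n)$ is the number of ways of writing $n$ as an ordered product of $k$ positive integers (so $\tau_1 \equiv 1$, $\tau_2 = \tau$ is the divisor function). -}

module Defs where

open import Axiom.ExcludedMiddle using (ExcludedMiddle)
open import Data.Bool.Base using (if_then_else_)
open import Data.Integer.Base as ℤ using (ℤ; +_; -[1+_]; 0ℤ; 1ℤ; -1ℤ)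
import Data.Integer.Properties as ℤ
open import Data.List.Base using (List; []; _∷_; map; foldr; length; filter; applyUpTo; cartesianProductWith)
open import Data.List.Membership.Propositional using (_∈_)
open import Data.List.Membership.Propositional.Properties using (∈-applyUpTo⁺; ∈-applyUpTo⁻)
open import Data.List.Relation.Unary.Unique.DecPropositional using (unique?)
open import Data.Nat.Base as ℕ using (ℕ; zero; suc; NonZero)
open import Data.Nat.Primality.Factorisation using (factorise; factors)
import Data.Nat.Properties as ℕ
open import Data.Product.Base using (∃; ∃-syntax; _×_; _,_; proj₁; proj₂)
open import Data.Rational.Base as ℚ using (ℚ; ↥_; ↧_; 1/_; *≤*; *<*)
open import Data.Rational.Literals using (fromℤ)
import Data.Rational.Properties as ℚ
open import Data.Sum.Base using (_⊎_; inj₁; inj₂)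
open import Data.Vec.Base as Vec using (Vec; []; _∷_)
open import Function.Base using (_∘_)
open import Function.Bundles using (_⇔_; mk⇔)
open import Level using (0ℓ)
open import Relation.Binary.PropositionalEquality
  using (_≡_; refl; sym; trans; cong; subst; subst₂)
open import Relation.Nullary using (¬_; yes; no; does; contradiction)

record ℕ⁺ : Set where
  constructor mkℕ⁺
  field
    value       : ℕ
    .{{nonZero}} : NonZero value

open ℕ⁺ public using (value)

1⁺ : ℕ⁺
1⁺ = mkℕ⁺ 1

infixl 7 _*⁺_

_*⁺_ : ℕ⁺ → ℕ⁺ → ℕ⁺
mkℕ⁺ m *⁺ mkℕ⁺ n = mkℕ⁺ (m ℕ.* n) {{ℕ.m*n≢0 m n}}

∏ : ∀ {k} → Vec ℕ⁺ k → ℕ⁺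
∏ = Vec.foldr (λ _ → ℕ⁺) _*⁺_ 1⁺

[1⋯_] : ℕ → List ℕ⁺
[1⋯ n ] = applyUpTo (λ i → mkℕ⁺ (suc i)) n

∑ : ∀ {A : Set} → List A → (A → ℤ) → ℤ
∑ xs f = foldr ℤ._+_ 0ℤ (map f xs)

infix 6 ∑
syntax ∑ xs (λ x → e) = ∑[ x ∈ xs ] e

tuples : ∀ {A : Set} k → List A → List (Vec A k)
tuples zero    xs = [] ∷ []
tuples (suc k) xs = cartesianProductWith _∷_ xs (tuples k xs)

-- The factors are listed with multiplicity, so they are pairwise distinct
-- exactly when n is squarefree.
μ : ℕ⁺ → ℤ
μ (mkℕ⁺ n) = if does (unique? ℕ._≟_ ps) then -1ℤ ℤ.^ length ps else 0ℤ
  where ps = factors (factorise n)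

-- Every entry of a tuple with product n is at most n, so it is enough to
-- search the tuples with entries in [1⋯ n ].
τ : ℕ → ℕ⁺ → ℕ
τ k n = length (filter (λ ds → value (∏ ds) ℕ.≟ value n) (tuples k [1⋯ value n ]))

-- Two-sided Dedekind cuts: L x q means q < x and U x q means x < q.
record ℝ : Set₁ where
  field
    L U         : ℚ → Set
    L-inhabited : ∃ L
    U-inhabited : ∃ U
    L-lower     : ∀ {p q} → p ℚ.< q → L q → L p
    U-upper     : ∀ {p q} → p ℚ.< q → U p → U q
    L-open      : ∀ {p} → L p → ∃[ q ] p ℚ.< q × L q
    U-open      : ∀ {q} → U q → ∃[ p ] p ℚ.< q × U p
    disjoint    : ∀ {q} → L q → ¬ U q
    located     : ∀ {p q} → p ℚ.< q → L p ⊎ U q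

open ℝ

infix 4 _≤ᴿ_ _<ᴿ_

_≤ᴿ_ : ℝ → ℝ → Set
x ≤ᴿ y = ∀ q → L x q → L y q

_<ᴿ_ : ℝ → ℝ → Set
x <ᴿ y = ∃[ q ] U x q × L y q

private
  fromℤ-mono-< : ∀ {m n} → m ℤ.< n → fromℤ m ℚ.< fromℤ n
  fromℤ-mono-< {m} {n} m<n =
    *<* (subst₂ ℤ._<_ (sym (ℤ.*-identityʳ m)) (sym (ℤ.*-identityʳ n)) m<n)

  fromℤ-cancel-< : ∀ {m n} → fromℤ m ℚ.< fromℤ n → m ℤ.< n
  fromℤ-cancel-< {m} {n} (*<* m<n) =
    subst₂ ℤ._<_ (ℤ.*-identityʳ m) (ℤ.*-identityʳ n) m<n

  i≤∣i∣ : ∀ i → i ℤ.≤ + ℤ.∣ i ∣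
  i≤∣i∣ (+ n)    = ℤ.≤-refl
  i≤∣i∣ -[1+ n ] = ℤ.-≤+

  i≤∣i∣*d : ∀ i d .{{_ : NonZero d}} → i ℤ.≤ + ℤ.∣ i ∣ ℤ.* + d
  i≤∣i∣*d i d = ℤ.≤-trans (i≤∣i∣ i)
    (subst (+ ℤ.∣ i ∣ ℤ.≤_) (ℤ.pos-* ℤ.∣ i ∣ d) (ℤ.+≤+ (ℕ.m≤m*n ℤ.∣ i ∣ d)))

  below : ℚ → ℤ
  below p = ℤ.- (+ ℤ.∣ ↥ p ∣)

  above : ℚ → ℤ
  above p = + ℤ.∣ ↥ p ∣

  above-≥ : ∀ p → p ℚ.≤ fromℤ (above p)
  above-≥ p = *≤* (subst (ℤ._≤ + ℤ.∣ ↥ p ∣ ℤ.* ↧ p) (sym (ℤ.*-identityʳ (↥ p)))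
    (i≤∣i∣*d (↥ p) (ℚ.↧ₙ p)))

  below-≤ : ∀ p → fromℤ (below p) ℚ.≤ p
  below-≤ p = *≤* (subst₂ ℤ._≤_ (ℤ.neg-distribˡ-* (+ ℤ.∣ ↥ p ∣) (↧ p))
    (trans (ℤ.neg-involutive (↥ p)) (sym (ℤ.*-identityʳ (↥ p))))
    (ℤ.neg-mono-≤ (subst (λ k → ℤ.- (↥ p) ℤ.≤ + k ℤ.* ↧ p) (ℤ.∣-i∣≡∣i∣ (↥ p))
      (i≤∣i∣*d (ℤ.- (↥ p)) (ℚ.↧ₙ p)))))

  below-< : ∀ p → fromℤ (below p ℤ.- 1ℤ) ℚ.< p
  below-< p = ℚ.<-≤-trans
    (fromℤ-mono-< (subst (below p ℤ.- 1ℤ ℤ.<_) (ℤ.+-identityʳ (below p))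
      (ℤ.+-monoʳ-< (below p) (ℤ.-<+ {0} {0}))))
    (below-≤ p)

  above-> : ∀ p → p ℚ.< fromℤ (above p ℤ.+ 1ℤ)
  above-> p = ℚ.≤-<-trans (above-≥ p) (fromℤ-mono-< (ℤ.+<+ (ℕ.m<m+n _ ℕ.z<s)))

fromℚ : ℚ → ℝ
fromℚ p = record
  { L           = ℚ._< p
  ; U           = p ℚ.<_
  ; L-inhabited = _ , below-< p
  ; U-inhabited = _ , above-> p
  ; L-lower     = ℚ.<-trans
  ; U-upper     = λ q<r p<q → ℚ.<-trans p<q q<r
  ; L-open      = λ q<p → let (r , q<r , r<p) = ℚ.<-dense q<p in r , q<r , r<p
  ; U-open      = λ p<q → let (r , p<r , r<q) = ℚ.<-dense p<q in r , r<q , p<r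
  ; disjoint    = ℚ.<-asym
  ; located     = located′
  }
  where
  located′ : ∀ {q r} → q ℚ.< r → q ℚ.< p ⊎ p ℚ.< r
  located′ {q} {r} q<r with q ℚ.<? p
  ... | yes q<p = inj₁ q<p
  ... | no  q≮p = inj₂ (ℚ.≤-<-trans (ℚ.≮⇒≥ q≮p) q<r)

fromInt : ℤ → ℝ
fromInt m = fromℚ (fromℤ m)

fromPos : ℕ⁺ → ℝ
fromPos n = fromInt (+ value n)

infixl 7 _÷_

-- q < x / n if and only if q n < x, and likewise for >.
_÷_ : ℝ → ℕ⁺ → ℝ
x ÷ mkℕ⁺ n@(suc _) = record
  { L           = λ q → L x (q ℚ.* d)
  ; U           = λ q → U x (q ℚ.* d)
  ; L-inhabited = let (q , Lq) = L-inhabited x in q / , subst (L x) (sym (/* q)) Lq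
  ; U-inhabited = let (q , Uq) = U-inhabited x in q / , subst (U x) (sym (/* q)) Uq
  ; L-lower     = λ p<q → L-lower x (ℚ.*-monoˡ-<-pos d p<q)
  ; U-upper     = λ p<q → U-upper x (ℚ.*-monoˡ-<-pos d p<q)
  ; L-open      = λ {p} Lp → let (q , p<q , Lq) = L-open x Lp in
      q / , ℚ.*-cancelʳ-<-nonNeg d (subst (p ℚ.* d ℚ.<_) (sym (/* q)) p<q)
          , subst (L x) (sym (/* q)) Lq
  ; U-open      = λ {q} Uq → let (p , p<q , Up) = U-open x Uq in
      p / , ℚ.*-cancelʳ-<-nonNeg d (subst (ℚ._< q ℚ.* d) (sym (/* p)) p<q)
          , subst (U x) (sym (/* p)) Up
  ; disjoint    = disjoint x
  ; located     = λ p<q → located x (ℚ.*-monoˡ-<-pos d p<q)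
  }
  where
  d : ℚ
  d = fromℤ (+ n)

  _/ : ℚ → ℚ
  q / = q ℚ.* 1/ d

  /* : ∀ q → q / ℚ.* d ≡ q
  /* q = trans (ℚ.*-assoc q (1/ d) d)
    (trans (cong (q ℚ.*_) (ℚ.*-inverseˡ d)) (ℚ.*-identityʳ q))

-- The floor of x is the unique integer m with m ≤ x < m + 1.
-- Constructively the integer part of an arbitrary real number need not
-- exist, so excluded middle is an explicit argument from here on.
IsFloor : ℝ → ℤ → Set
IsFloor x m = fromInt m ≤ᴿ x × x <ᴿ fromInt (m ℤ.+ 1ℤ)

floor-exists : ExcludedMiddle 0ℓ → ∀ x → ∃ (IsFloor x)
floor-exists em x = search (ℤ.∣ ↥ u ∣ ℕ.+ ℤ.∣ ↥ l ∣) (below l) ¬U-below U-above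
  where
  l = proj₁ (L-inhabited x)
  u = proj₁ (U-inhabited x)

  U-≤ : ∀ {p q} → p ℚ.≤ q → U x p → U x q
  U-≤ p≤q Up = let (r , r<p , Ur) = U-open x Up in U-upper x (ℚ.<-≤-trans r<p p≤q) Ur

  ¬U-below : ¬ U x (fromℤ (below l))
  ¬U-below U-b = disjoint x (proj₂ (L-inhabited x)) (U-≤ (below-≤ l) U-b)

  U-above : U x (fromℤ (below l ℤ.+ + (ℤ.∣ ↥ u ∣ ℕ.+ ℤ.∣ ↥ l ∣)))
  U-above = subst (U x ∘ fromℤ) (sym eq) (U-≤ (above-≥ u) (proj₂ (U-inhabited x)))
    where
    eq : below l ℤ.+ (+ ℤ.∣ ↥ u ∣ ℤ.+ + ℤ.∣ ↥ l ∣) ≡ above u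
    eq = trans (cong (λ k → below l ℤ.+ k) (ℤ.+-comm (above u) (above l)))
      (trans (sym (ℤ.+-assoc (below l) (above l) (above u)))
        (trans (cong (ℤ._+ above u) (ℤ.+-inverseˡ (above l))) (ℤ.+-identityˡ (above u))))

  isFloor : ∀ m → ¬ U x (fromℤ m) → U x (fromℤ (m ℤ.+ 1ℤ)) → IsFloor x m
  isFloor m ¬Um Um+1 = m≤x , (let (r , r<m+1 , Ur) = U-open x Um+1 in r , Ur , r<m+1)
    where
    m≤x : fromInt m ≤ᴿ x
    m≤x q q<m with located x q<m
    ... | inj₁ Lq = Lq
    ... | inj₂ Um = contradiction Um ¬Um

  search : ∀ k a → ¬ U x (fromℤ a) → U x (fromℤ (a ℤ.+ + k)) → ∃ (IsFloor x)
  search zero    a ¬Ua Ua+k = contradiction (subst (U x ∘ fromℤ) (ℤ.+-identityʳ a) Ua+k) ¬Ua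
  search (suc k) a ¬Ua Ua+k with em {U x (fromℤ (a ℤ.+ 1ℤ))}
  ... | yes Ua+1 = a , isFloor a ¬Ua Ua+1
  ... | no ¬Ua+1 = search k (a ℤ.+ 1ℤ) ¬Ua+1
                     (subst (U x ∘ fromℤ) (sym (ℤ.+-assoc a 1ℤ (+ k))) Ua+k)

floor : ExcludedMiddle 0ℓ → ℝ → ℤ
floor em x = proj₁ (floor-exists em x)

floor-isFloor : ∀ (em : ExcludedMiddle 0ℓ) x → IsFloor x (floor em x)
floor-isFloor em x = proj₂ (floor-exists em x)

[1⋯_]ℤ : ℤ → List ℕ⁺
[1⋯ + n      ]ℤ = [1⋯ n ]
[1⋯ -[1+ _ ] ]ℤ = []

positives≤ : ExcludedMiddle 0ℓ → ℝ → List ℕ⁺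
positives≤ em x = [1⋯ floor em x ]ℤ

∈-positives≤ : ∀ (em : ExcludedMiddle 0ℓ) x n → n ∈ positives≤ em x ⇔ fromPos n ≤ᴿ x
∈-positives≤ em x n = mk⇔ (to (floor em x) (proj₁ (floor-isFloor em x)))
                          (from n (floor em x) (proj₂ (floor-isFloor em x)))
  where
  to : ∀ m → fromInt m ≤ᴿ x → n ∈ [1⋯ m ]ℤ → fromPos n ≤ᴿ x
  to (+ m) m≤x n∈ q q<n with ∈-applyUpTo⁻ (λ i → mkℕ⁺ (suc i)) n∈
  ... | i , i<m , refl = m≤x q (ℚ.<-≤-trans q<n (*≤* (ℤ.*-monoʳ-≤-nonNeg 1ℤ (ℤ.+≤+ i<m))))

  from : ∀ n m → x <ᴿ fromInt (m ℤ.+ 1ℤ) → fromPos n ≤ᴿ x → n ∈ [1⋯ m ]ℤ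
  from (mkℕ⁺ n@(suc i)) m (q , Uq , q<m+1) n≤x = ∈ m (fromℤ-cancel-< (ℚ.≤-<-trans n≤q q<m+1))
    where
    n≤q : fromℤ (+ n) ℚ.≤ q
    n≤q = ℚ.≮⇒≥ (λ q<n → disjoint x (n≤x q q<n) Uq)

    ∈ : ∀ m → + n ℤ.< m ℤ.+ 1ℤ → mkℕ⁺ n ∈ [1⋯ m ]ℤ
    ∈ (+ m) (ℤ.+<+ n<m+1) = ∈-applyUpTo⁺ (λ i → mkℕ⁺ (suc i))
      (ℕ.s≤s⁻¹ (subst (suc n ℕ.≤_) (ℕ.+-comm m 1) n<m+1))
    ∈ -[1+ zero ]  (ℤ.+<+ ())
    ∈ -[1+ suc _ ] ()

{-# OPTIONS --safe #-}
module Submission where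

-- By symmetry each of the r summands μ(nᵢ) contributes the same amount, and
-- ⌊x/(n₁⋯n_r)⌋ = ⌊⌊x/(n₂⋯n_r)⌋/n₁⌋. The classical identity
-- ∑_{n ≤ N} μ(n)⌊M/n⌋ = 1 for 1 ≤ M ≤ N then collapses the sum over n₁ to the
-- indicator of n₂⋯n_r ≤ x, and counting these tuples by their product gives
-- ∑_{n ≤ x} τ_{r-1}(n).

open import Axiom.ExcludedMiddle using (ExcludedMiddle)
open import Algebra.Properties.CommutativeSemigroup using (interchange; x∙yz≈y∙xz)
open import Data.Bool.Base using (true; false; if_then_else_)
open import Data.Integer.Base as ℤ using (ℤ; +_; -[1+_]; -_; _+_; _*_; 0ℤ; 1ℤ; -1ℤ)
import Data.Integer.Properties as ℤ
open import Data.List.Base using (List; []; _∷_; _++_; _∷ʳ_; map; length; filter; cartesianProductWith)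
open import Data.List.Membership.Propositional using (_∈_; _∉_)
open import Data.List.Membership.Propositional.Properties using (∈-applyUpTo⁻)
open import Data.List.Properties using (applyUpTo-∷ʳ)
open import Data.List.Relation.Binary.Permutation.Propositional using (_↭_; ↭-sym; ↭⇒↭ₛ)
open import Data.List.Relation.Binary.Permutation.Propositional.Properties using (↭-length)
open import Data.List.Relation.Binary.Permutation.Setoid.Properties using (Unique-resp-↭)
open import Data.List.Relation.Unary.All using (_∷_)
open import Data.List.Relation.Unary.All.Properties using (¬Any⇒All¬; All¬⇒¬Any)
open import Data.List.Relation.Unary.AllPairs using (_∷_)
open import Data.List.Relation.Unary.Any using (here; there)
open import Data.List.Relation.Unary.Unique.DecPropositional using (unique?)
open import Data.Nat.Base as ℕ using (ℕ; zero; suc; NonZero; _≤_; _<_; _∸_; _/_; _%_; s≤s)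
open import Data.Nat.Divisibility
  using (_∣_; _∣?_; divides; divides-refl; m*n∣⇒n∣; *-monoˡ-∣; m∣m*n; ∣m+n∣m⇒∣n; n∣m*n; 1∣_; >⇒∤; ∣1⇒≡1)
open import Data.Nat.DivMod
  using (+-distrib-/-∣ʳ; m<n⇒m/n≡0; m*n/n≡m; 0/n≡0; m≡m%n+[m/n]*n;
    m%n<n; m/n*n≤m; m/n≤m; m/n/o≡m/[n*o]; m≥n⇒m/n>0; m/n≢0⇒n≤m)
open import Data.Nat.ListAction using (product)
open import Data.Nat.ListAction.Properties using (∈⇒∣product)
open import Data.Nat.Primality using (Prime; euclidsLemma; prime⇒nonZero)
open import Data.Nat.Primality.Factorisation
  using (PrimeFactorisation; factorise; factors; factorisationUnique; factorisationHasAllPrimeFactors)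
import Data.Nat.Properties as ℕ
open import Data.Product.Base using (∃-syntax; _×_; _,_)
open import Data.Rational.Base as ℚ using (*≤*; *<*)
open import Data.Rational.Literals using (fromℤ)
import Data.Rational.Properties as ℚ
open import Data.Sum.Base using (inj₁; inj₂)
open import Data.Vec.Base using (Vec; _∷_; toList)
open import Function.Base using (_∘_)
open import Function.Bundles using (mk⇔)
open import Level using (0ℓ)
open import Relation.Binary.PropositionalEquality
  using (_≡_; _≢_; refl; sym; trans; cong; cong₂; subst; subst₂; setoid; module ≡-Reasoning)
open import Relation.Nullary using (¬_; Dec; yes; no; does; ¬?; contradiction)
open import Relation.Nullary.Decidable using (dec-true; dec-false; does-⇔)
open import Relation.Unary using (Pred; Decidable)
open import Defs

open ≡-Reasoning

private
  variable
    A B C : Set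
    P Q   : Set

-- Indicators and finite sums

𝟙 : Dec P → ℤ
𝟙 P? = if does P? then 1ℤ else 0ℤ

𝟙-true : (P? : Dec P) → P → 𝟙 P? ≡ 1ℤ
𝟙-true P? p = cong (if_then 1ℤ else 0ℤ) (dec-true P? p)

𝟙-false : (P? : Dec P) → ¬ P → 𝟙 P? ≡ 0ℤ
𝟙-false P? ¬p = cong (if_then 1ℤ else 0ℤ) (dec-false P? ¬p)

𝟙-⇔ : (P? : Dec P) (Q? : Dec Q) → (P → Q) → (Q → P) → 𝟙 P? ≡ 𝟙 Q?
𝟙-⇔ P? Q? to from = cong (if_then 1ℤ else 0ℤ) (does-⇔ (mk⇔ to from) P? Q?)

∑-cong-∈ : ∀ xs {f g : A → ℤ} → (∀ {x} → x ∈ xs → f x ≡ g x) → ∑ xs f ≡ ∑ xs g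
∑-cong-∈ []       f≗g = refl
∑-cong-∈ (x ∷ xs) f≗g = cong₂ _+_ (f≗g (here refl)) (∑-cong-∈ xs (f≗g ∘ there))

∑-cong : ∀ (xs : List A) {f g : A → ℤ} → (∀ x → f x ≡ g x) → ∑ xs f ≡ ∑ xs g
∑-cong xs f≗g = ∑-cong-∈ xs (λ {x} _ → f≗g x)

∑-zero : ∀ (xs : List A) → (∑[ x ∈ xs ] 0ℤ) ≡ 0ℤ
∑-zero []       = refl
∑-zero (x ∷ xs) = trans (ℤ.+-identityˡ _) (∑-zero xs)

∑-+ : ∀ (xs : List A) (f g : A → ℤ) → (∑[ x ∈ xs ] (f x + g x)) ≡ ∑ xs f + ∑ xs g
∑-+ []       f g = refl
∑-+ (x ∷ xs) f g = trans (cong (_+_ (f x + g x)) (∑-+ xs f g))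
  (interchange ℤ.+-commutativeSemigroup (f x) (g x) (∑ xs f) (∑ xs g))

∑-*ˡ : ∀ (xs : List A) c (f : A → ℤ) → (∑[ x ∈ xs ] c * f x) ≡ c * ∑ xs f
∑-*ˡ []       c f = sym (ℤ.*-zeroʳ c)
∑-*ˡ (x ∷ xs) c f = trans (cong (_+_ (c * f x)) (∑-*ˡ xs c f)) (sym (ℤ.*-distribˡ-+ c (f x) (∑ xs f)))

∑-*ʳ : ∀ (xs : List A) (f : A → ℤ) c → (∑[ x ∈ xs ] f x * c) ≡ ∑ xs f * c
∑-*ʳ xs f c = begin
  ∑[ x ∈ xs ] f x * c  ≡⟨ ∑-cong xs (λ x → ℤ.*-comm (f x) c) ⟩
  ∑[ x ∈ xs ] c * f x  ≡⟨ ∑-*ˡ xs c f ⟩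
  c * ∑ xs f           ≡⟨ ℤ.*-comm c (∑ xs f) ⟩
  ∑ xs f * c           ∎

∑-swap : ∀ (xs : List A) (ys : List B) (f : A → B → ℤ) →
  (∑[ x ∈ xs ] (∑[ y ∈ ys ] f x y)) ≡ (∑[ y ∈ ys ] (∑[ x ∈ xs ] f x y))
∑-swap []       ys f = sym (∑-zero ys)
∑-swap (x ∷ xs) ys f = trans (cong (_+_ (∑ ys (f x))) (∑-swap xs ys f))
  (sym (∑-+ ys (f x) (λ y → ∑[ x ∈ xs ] f x y)))

∑-++ : ∀ (xs ys : List A) (f : A → ℤ) → ∑ (xs ++ ys) f ≡ ∑ xs f + ∑ ys f
∑-++ []       ys f = sym (ℤ.+-identityˡ _)
∑-++ (x ∷ xs) ys f = trans (cong (_+_ (f x)) (∑-++ xs ys f)) (sym (ℤ.+-assoc (f x) (∑ xs f) (∑ ys f)))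

∑-map : ∀ (h : A → B) xs (f : B → ℤ) → ∑ (map h xs) f ≡ ∑ xs (f ∘ h)
∑-map h []       f = refl
∑-map h (x ∷ xs) f = cong (_+_ (f (h x))) (∑-map h xs f)

∑-cartesianProductWith : ∀ (h : A → B → C) xs ys (f : C → ℤ) →
  ∑ (cartesianProductWith h xs ys) f ≡ (∑[ x ∈ xs ] (∑[ y ∈ ys ] f (h x y)))
∑-cartesianProductWith h []       ys f = refl
∑-cartesianProductWith h (x ∷ xs) ys f =
  trans (∑-++ (map (h x) ys) (cartesianProductWith h xs ys) f)
    (cong₂ _+_ (∑-map (h x) ys f) (∑-cartesianProductWith h xs ys f))

∑-tuples : ∀ k (xs : List A) (f : Vec A (suc k) → ℤ) →
  ∑ (tuples (suc k) xs) f ≡ (∑[ x ∈ xs ] (∑[ v ∈ tuples k xs ] f (x ∷ v)))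
∑-tuples k xs = ∑-cartesianProductWith _∷_ xs (tuples k xs)

∑-filter : ∀ {P : Pred A 0ℓ} (P? : Decidable P) xs → + length (filter P? xs) ≡ (∑[ x ∈ xs ] 𝟙 (P? x))
∑-filter P? []       = refl
∑-filter P? (x ∷ xs) with does (P? x)
... | true  = cong (_+_ 1ℤ) (∑-filter P? xs)
... | false = trans (∑-filter P? xs) (sym (ℤ.+-identityˡ _))

-- Sums over [1⋯ N ]

∈[1⋯]⇒≤ : ∀ N {n} → n ∈ [1⋯ N ] → value n ≤ N
∈[1⋯]⇒≤ N n∈ with i , i<N , refl ← ∈-applyUpTo⁻ (λ i → mkℕ⁺ (suc i)) n∈ = i<N

∑-[1⋯suc] : ∀ N (f : ℕ⁺ → ℤ) → ∑ [1⋯ suc N ] f ≡ ∑ [1⋯ N ] f + f (mkℕ⁺ (suc N))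
∑-[1⋯suc] N f = begin
  ∑ [1⋯ suc N ] f                      ≡⟨ cong (λ xs → ∑ xs f) (applyUpTo-∷ʳ (λ i → mkℕ⁺ (suc i)) N) ⟨
  ∑ ([1⋯ N ] ∷ʳ mkℕ⁺ (suc N)) f        ≡⟨ ∑-++ [1⋯ N ] (mkℕ⁺ (suc N) ∷ []) f ⟩
  ∑ [1⋯ N ] f + (f (mkℕ⁺ (suc N)) + 0ℤ) ≡⟨ cong (λ z → ∑ [1⋯ N ] f + z) (ℤ.+-identityʳ _) ⟩
  ∑ [1⋯ N ] f + f (mkℕ⁺ (suc N))       ∎

-- The terms beyond `n` vanish; recursion on `≤′` removes them one at a time from the top.
∑-truncate : ∀ {n N} → n ℕ.≤′ N → (f : ℕ⁺ → ℤ) → (∀ d → n < value d → f d ≡ 0ℤ) →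
  ∑ [1⋯ N ] f ≡ ∑ [1⋯ n ] f
∑-truncate     ℕ.≤′-refl            f f≡0 = refl
∑-truncate {n} (ℕ.≤′-step {N} n≤N) f f≡0 = begin
  ∑ [1⋯ suc N ] f                 ≡⟨ ∑-[1⋯suc] N f ⟩
  ∑ [1⋯ N ] f + f (mkℕ⁺ (suc N))  ≡⟨ cong₂ _+_ (∑-truncate n≤N f f≡0) (f≡0 _ (s≤s (ℕ.≤′⇒≤ n≤N))) ⟩
  ∑ [1⋯ n ] f + 0ℤ                ≡⟨ ℤ.+-identityʳ _ ⟩
  ∑ [1⋯ n ] f                     ∎

-- An entry of a tuple is at most the product, so a tuple with an entry above `n` has product above
-- `n`, where `g` vanishes. The induction lets `g` vary because fixing the head `d` replaces it by
-- the map sending `e` to `g (d *⁺ e)`.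
∑-tuples-truncate : ∀ k {n N} → n ≤ N → (g : ℕ⁺ → ℤ) → (∀ d → n < value d → g d ≡ 0ℤ) →
  (∑[ ds ∈ tuples k [1⋯ N ] ] g (∏ ds)) ≡ (∑[ ds ∈ tuples k [1⋯ n ] ] g (∏ ds))
∑-tuples-truncate zero    n≤N g g≡0 = refl
∑-tuples-truncate (suc k) {n} {N} n≤N g g≡0 = begin
  ∑[ ds ∈ tuples (suc k) [1⋯ N ] ] g (∏ ds)
    ≡⟨ ∑-tuples k [1⋯ N ] (g ∘ ∏) ⟩
  ∑[ d ∈ [1⋯ N ] ] (∑[ ds ∈ tuples k [1⋯ N ] ] g (d *⁺ ∏ ds))
    ≡⟨ ∑-cong [1⋯ N ] (λ d → ∑-tuples-truncate k n≤N (λ e → g (d *⁺ e))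
         (λ e n<e → g≡0 (d *⁺ e) (ℕ.<-≤-trans n<e (≤-*⁺ˡ d e)))) ⟩
  ∑[ d ∈ [1⋯ N ] ] (∑[ ds ∈ tuples k [1⋯ n ] ] g (d *⁺ ∏ ds))
    ≡⟨ ∑-truncate (ℕ.≤⇒≤′ n≤N) _ (λ d n<d →
         trans (∑-cong (tuples k [1⋯ n ]) (λ ds → g≡0 (d *⁺ ∏ ds) (ℕ.<-≤-trans n<d (≤-*⁺ʳ d (∏ ds)))))
           (∑-zero (tuples k [1⋯ n ]))) ⟩
  ∑[ d ∈ [1⋯ n ] ] (∑[ ds ∈ tuples k [1⋯ n ] ] g (d *⁺ ∏ ds))
    ≡⟨ ∑-tuples k [1⋯ n ] (g ∘ ∏) ⟨
  ∑[ ds ∈ tuples (suc k) [1⋯ n ] ] g (∏ ds) ∎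
  where
  ≤-*⁺ˡ : ∀ d e → value e ≤ value (d *⁺ e)
  ≤-*⁺ˡ (mkℕ⁺ d) (mkℕ⁺ e) = ℕ.m≤n*m e d

  ≤-*⁺ʳ : ∀ d e → value d ≤ value (d *⁺ e)
  ≤-*⁺ʳ (mkℕ⁺ d) (mkℕ⁺ e) = ℕ.m≤m*n d e

-- Sifting by a Kronecker delta; the indicator on the right records whether `c` lies in the range of
-- summation.
∑-δ : ∀ N c (g : ℕ⁺ → ℤ) →
  (∑[ n ∈ [1⋯ N ] ] 𝟙 (value c ℕ.≟ value n) * g n) ≡ 𝟙 (value c ℕ.≤? N) * g c
∑-δ zero    c@(mkℕ⁺ (suc _)) g = refl
∑-δ (suc N) c g = begin
  ∑[ n ∈ [1⋯ suc N ] ] 𝟙 (value c ℕ.≟ value n) * g n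
    ≡⟨ ∑-[1⋯suc] N _ ⟩
  (∑[ n ∈ [1⋯ N ] ] 𝟙 (value c ℕ.≟ value n) * g n) + 𝟙 (value c ℕ.≟ suc N) * g (mkℕ⁺ (suc N))
    ≡⟨ cong (λ z → z + 𝟙 (value c ℕ.≟ suc N) * g (mkℕ⁺ (suc N))) (∑-δ N c g) ⟩
  𝟙 (value c ℕ.≤? N) * g c + 𝟙 (value c ℕ.≟ suc N) * g (mkℕ⁺ (suc N))
    ≡⟨ step ⟩
  𝟙 (value c ℕ.≤? suc N) * g c ∎
  where
  step : 𝟙 (value c ℕ.≤? N) * g c + 𝟙 (value c ℕ.≟ suc N) * g (mkℕ⁺ (suc N)) ≡ 𝟙 (value c ℕ.≤? suc N) * g c
  step with value c ℕ.≟ suc N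
  ... | yes refl = begin
    𝟙 (suc N ℕ.≤? N) * g c + 𝟙 (suc N ℕ.≟ suc N) * g c
      ≡⟨ cong₂ (λ a b → a * g c + b * g c)
           (𝟙-false (suc N ℕ.≤? N) (ℕ.<-irrefl refl)) (𝟙-true (suc N ℕ.≟ suc N) refl) ⟩
    0ℤ + 1ℤ * g c              ≡⟨ ℤ.+-identityˡ _ ⟩
    1ℤ * g c                   ≡⟨ cong (_* g c) (𝟙-true (suc N ℕ.≤? suc N) ℕ.≤-refl) ⟨
    𝟙 (suc N ℕ.≤? suc N) * g c ∎
  ... | no c≢1+N = begin
    𝟙 (value c ℕ.≤? N) * g c + 𝟙 (value c ℕ.≟ suc N) * g (mkℕ⁺ (suc N))
      ≡⟨ cong (λ z → 𝟙 (value c ℕ.≤? N) * g c + z * g (mkℕ⁺ (suc N))) (𝟙-false (value c ℕ.≟ suc N) c≢1+N) ⟩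
    𝟙 (value c ℕ.≤? N) * g c + 0ℤ ≡⟨ ℤ.+-identityʳ _ ⟩
    𝟙 (value c ℕ.≤? N) * g c
      ≡⟨ cong (_* g c) (𝟙-⇔ (value c ℕ.≤? N) (value c ℕ.≤? suc N) ℕ.m≤n⇒m≤1+n
           (λ c≤ → ℕ.s≤s⁻¹ (ℕ.≤∧≢⇒< c≤ c≢1+N))) ⟩
    𝟙 (value c ℕ.≤? suc N) * g c ∎

∑-𝟙≡ : ∀ N c → (∑[ n ∈ [1⋯ N ] ] 𝟙 (value c ℕ.≟ value n)) ≡ 𝟙 (value c ℕ.≤? N)
∑-𝟙≡ N c = begin
  ∑[ n ∈ [1⋯ N ] ] 𝟙 (value c ℕ.≟ value n)       ≡⟨ ∑-cong [1⋯ N ] (λ _ → ℤ.*-identityʳ _) ⟨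
  ∑[ n ∈ [1⋯ N ] ] 𝟙 (value c ℕ.≟ value n) * 1ℤ  ≡⟨ ∑-δ N c (λ _ → 1ℤ) ⟩
  𝟙 (value c ℕ.≤? N) * 1ℤ                        ≡⟨ ℤ.*-identityʳ _ ⟩
  𝟙 (value c ℕ.≤? N)                             ∎

-- Cancelling `q` leaves at most one cofactor `e`, and it is at most `d`, hence within the range.
∑-𝟙≡-multiple : ∀ N q d → value d ≤ N →
  (∑[ e ∈ [1⋯ N ] ] 𝟙 (value (q *⁺ e) ℕ.≟ value d)) ≡ 𝟙 (value q ∣? value d)
∑-𝟙≡-multiple N q@(mkℕ⁺ q′) d@(mkℕ⁺ d′ {{d≢0}}) d≤N with value q ∣? value d
... | no q∤d = begin
  ∑[ e ∈ [1⋯ N ] ] 𝟙 (value (q *⁺ e) ℕ.≟ value d)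
    ≡⟨ ∑-cong [1⋯ N ] (λ e → 𝟙-false (value (q *⁺ e) ℕ.≟ value d)
         (λ qe≡d → q∤d (subst (q′ ∣_) qe≡d (m∣m*n (value e))))) ⟩
  ∑[ e ∈ [1⋯ N ] ] 0ℤ       ≡⟨ ∑-zero [1⋯ N ] ⟩
  0ℤ                        ∎
... | yes (divides e₀@(suc _) d≡e₀q) = begin
  ∑[ e ∈ [1⋯ N ] ] 𝟙 (value (q *⁺ e) ℕ.≟ value d)
    ≡⟨ ∑-cong [1⋯ N ] (λ e → 𝟙-⇔ (value (q *⁺ e) ℕ.≟ value d) (e₀ ℕ.≟ value e)
         (λ qe≡d → ℕ.*-cancelˡ-≡ e₀ (value e) q′ (trans d≡qe₀ (sym qe≡d)))
         (λ { refl → d≡qe₀ })) ⟩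
  ∑[ e ∈ [1⋯ N ] ] 𝟙 (e₀ ℕ.≟ value e) ≡⟨ ∑-𝟙≡ N (mkℕ⁺ e₀) ⟩
  𝟙 (e₀ ℕ.≤? N)                       ≡⟨ 𝟙-true (e₀ ℕ.≤? N) (ℕ.≤-trans e₀≤d d≤N) ⟩
  1ℤ                                  ∎
  where
  d≡qe₀ : q′ ℕ.* e₀ ≡ d′
  d≡qe₀ = trans (ℕ.*-comm q′ e₀) (sym d≡e₀q)

  e₀≤d : e₀ ≤ d′
  e₀≤d = subst (e₀ ≤_) d≡qe₀ (ℕ.m≤n*m e₀ q′)
-- A zero quotient would force `d` to be zero.
∑-𝟙≡-multiple N q (mkℕ⁺ (suc _)) d≤N | yes (divides zero ())

-- Substitution of `q *⁺ e` for `d`: the divisibility indicator is expanded as a count of cofactors,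
-- the sums are swapped and the delta is sifted out. Products beyond `N` do no harm, since `f`
-- vanishes there.
∑-multiples : ∀ N q (f : ℕ⁺ → ℤ) → (∀ d → N < value d → f d ≡ 0ℤ) →
  (∑[ d ∈ [1⋯ N ] ] 𝟙 (value q ∣? value d) * f d) ≡ (∑[ e ∈ [1⋯ N ] ] f (q *⁺ e))
∑-multiples N q f f≡0 = begin
  ∑[ d ∈ [1⋯ N ] ] 𝟙 (value q ∣? value d) * f d
    ≡⟨ ∑-cong-∈ [1⋯ N ] (λ {d} d∈ →
         cong (_* f d) (sym (∑-𝟙≡-multiple N q d (∈[1⋯]⇒≤ N d∈)))) ⟩
  ∑[ d ∈ [1⋯ N ] ] (∑[ e ∈ [1⋯ N ] ] 𝟙 (value (q *⁺ e) ℕ.≟ value d)) * f d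
    ≡⟨ ∑-cong [1⋯ N ] (λ d → ∑-*ʳ [1⋯ N ] _ (f d)) ⟨
  ∑[ d ∈ [1⋯ N ] ] (∑[ e ∈ [1⋯ N ] ] 𝟙 (value (q *⁺ e) ℕ.≟ value d) * f d)
    ≡⟨ ∑-swap [1⋯ N ] [1⋯ N ] _ ⟩
  ∑[ e ∈ [1⋯ N ] ] (∑[ d ∈ [1⋯ N ] ] 𝟙 (value (q *⁺ e) ℕ.≟ value d) * f d)
    ≡⟨ ∑-cong [1⋯ N ] (λ e → trans (∑-δ N (q *⁺ e) f) (cutoff (q *⁺ e))) ⟩
  ∑[ e ∈ [1⋯ N ] ] f (q *⁺ e) ∎
  where
  cutoff : ∀ d → 𝟙 (value d ℕ.≤? N) * f d ≡ f d
  cutoff d with value d ℕ.≤? N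
  ... | yes d≤N = trans (cong (_* f d) (𝟙-true (value d ℕ.≤? N) d≤N)) (ℤ.*-identityˡ (f d))
  ... | no  d≰N = trans (cong (_* f d) (𝟙-false (value d ℕ.≤? N) d≰N)) (sym (f≡0 d (ℕ.≰⇒> d≰N)))

-- The Möbius function

-- The body of `μ` as a function of the factor list alone, so that the list produced by `factorise`
-- can be exchanged for a permutation of it.
μ-list : List ℕ → ℤ
μ-list ps = if does (unique? ℕ._≟_ ps) then -1ℤ ℤ.^ length ps else 0ℤ

μ-list-↭ : ∀ {ps qs} → ps ↭ qs → μ-list ps ≡ μ-list qs
μ-list-↭ {ps} {qs} ps↭qs = cong₂ (λ b k → if b then -1ℤ ℤ.^ k else 0ℤ)
  (does-⇔ (mk⇔ (Unique-resp-↭ (setoid ℕ) (↭⇒↭ₛ ps↭qs)) (Unique-resp-↭ (setoid ℕ) (↭⇒↭ₛ (↭-sym ps↭qs))))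
    (unique? ℕ._≟_ ps) (unique? ℕ._≟_ qs))
  (↭-length ps↭qs)

μ-list-∈ : ∀ {p ps} → p ∈ ps → μ-list (p ∷ ps) ≡ 0ℤ
μ-list-∈ {p} {ps} p∈ps = cong (if_then -1ℤ ℤ.^ length (p ∷ ps) else 0ℤ)
  (dec-false (unique? ℕ._≟_ (p ∷ ps)) λ { (p∉ps ∷ _) → All¬⇒¬Any p∉ps p∈ps })

-- A new entry does not affect whether the rest is free of repetitions, and it raises the length by
-- one.
μ-list-∉ : ∀ {p ps} → p ∉ ps → μ-list (p ∷ ps) ≡ - μ-list ps
μ-list-∉ {p} {ps} p∉ps = trans
  (cong (if_then -1ℤ ℤ.^ length (p ∷ ps) else 0ℤ)
    (does-⇔ (mk⇔ (λ { (_ ∷ u) → u }) (¬Any⇒All¬ ps p∉ps ∷_))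
      (unique? ℕ._≟_ (p ∷ ps)) (unique? ℕ._≟_ ps)))
  (negate (does (unique? ℕ._≟_ ps)))
  where
  negate : ∀ b → (if b then -1ℤ ℤ.^ length (p ∷ ps) else 0ℤ) ≡ - (if b then -1ℤ ℤ.^ length ps else 0ℤ)
  negate true  = ℤ.-1*i≡-i (-1ℤ ℤ.^ length ps)
  negate false = refl

open PrimeFactorisation using (isFactorisation; factorsPrime)

-- Putting `p` in front of the factors of `m` gives a prime factorisation of the product, so by
-- uniqueness it is a permutation of the computed one.
μ-prime-* : ∀ p m .{{_ : NonZero m}} → Prime (value p) →
  μ (p *⁺ mkℕ⁺ m) ≡ μ-list (value p ∷ factors (factorise m))
μ-prime-* (mkℕ⁺ p) m p-prime = μ-list-↭ (factorisationUnique (factorise (p ℕ.* m) {{ℕ.m*n≢0 p m}}) record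
  { factors         = p ∷ factors (factorise m)
  ; isFactorisation = cong (p ℕ.*_) (isFactorisation (factorise m))
  ; factorsPrime    = p-prime ∷ factorsPrime (factorise m)
  })

-- Here `p` already occurs among the prime factors of `m`, so the extended list has a repetition.
μ-prime-*-∣ : ∀ p m → Prime (value p) → value p ∣ value m → μ (p *⁺ m) ≡ 0ℤ
μ-prime-*-∣ p (mkℕ⁺ m) p-prime p∣m = trans (μ-prime-* p m p-prime)
  (μ-list-∈ (factorisationHasAllPrimeFactors p-prime
    (subst (value p ∣_) (isFactorisation (factorise m)) p∣m) (factorsPrime (factorise m))))

-- Every listed factor divides `m`, so `p` is not among them and only the sign changes.
μ-prime-*-∤ : ∀ p m → Prime (value p) → ¬ (value p ∣ value m) → μ (p *⁺ m) ≡ - μ m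
μ-prime-*-∤ p (mkℕ⁺ m) p-prime p∤m = trans (μ-prime-* p m p-prime)
  (μ-list-∉ (λ p∈ → p∤m (subst (value p ∣_) (sym (isFactorisation (factorise m))) (∈⇒∣product {ns = factors (factorise m)} p∈))))

primeDivisor : ∀ m .{{_ : NonZero m}} → m ≢ 1 → ∃[ p ] Prime (value p) × value p ∣ m
primeDivisor m m≢1 with factorise m
... | record { factors = [] ; isFactorisation = m≡1 } = contradiction m≡1 m≢1
... | record { factors = p ∷ ps ; isFactorisation = m≡pΠ ; factorsPrime = p-prime ∷ _ } =
  mkℕ⁺ p {{prime⇒nonZero p-prime}} , p-prime , subst (p ∣_) (sym m≡pΠ) (m∣m*n (product ps))

-- For m > 1 fix a prime p ∣ m. The divisors d with p ∤ d cancel against the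
-- divisors p d; all others are divisible by p², where μ vanishes.
∑-μ-divisors : ∀ N m .{{_ : NonZero m}} → m ≤ N → (∑[ d ∈ [1⋯ N ] ] 𝟙 (value d ∣? m) * μ d) ≡ 𝟙 (m ℕ.≟ 1)
∑-μ-divisors N m m≤N with m ℕ.≟ 1
... | yes refl = begin
  ∑[ d ∈ [1⋯ N ] ] 𝟙 (value d ∣? 1) * μ d
    ≡⟨ ∑-cong [1⋯ N ] (λ d → cong (_* μ d)
         (𝟙-⇔ (value d ∣? 1) (1 ℕ.≟ value d) (sym ∘ ∣1⇒≡1) (λ { refl → 1∣ 1 }))) ⟩
  ∑[ d ∈ [1⋯ N ] ] 𝟙 (1 ℕ.≟ value d) * μ d ≡⟨ ∑-δ N 1⁺ μ ⟩
  -- `μ 1⁺` evaluates to `1ℤ`, the factor list of 1 being empty.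
  𝟙 (1 ℕ.≤? N) * 1ℤ                        ≡⟨ ℤ.*-identityʳ _ ⟩
  𝟙 (1 ℕ.≤? N)                             ≡⟨ 𝟙-true (1 ℕ.≤? N) m≤N ⟩
  1ℤ                                       ∎
... | no m≢1 with p , p-prime , p∣m ← primeDivisor m m≢1 = begin
  ∑[ d ∈ [1⋯ N ] ] F d
    ≡⟨ ∑-cong [1⋯ N ] split ⟩
  ∑[ d ∈ [1⋯ N ] ] (𝟙 (¬? (value p ∣? value d)) * F d + 𝟙 (value p ∣? value d) * F d)
    ≡⟨ ∑-+ [1⋯ N ] _ _ ⟩
  (∑[ d ∈ [1⋯ N ] ] 𝟙 (¬? (value p ∣? value d)) * F d) + (∑[ d ∈ [1⋯ N ] ] 𝟙 (value p ∣? value d) * F d)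
    ≡⟨ cong (λ z → (∑[ d ∈ [1⋯ N ] ] 𝟙 (¬? (value p ∣? value d)) * F d) + z) (∑-multiples N p F F≡0) ⟩
  (∑[ d ∈ [1⋯ N ] ] 𝟙 (¬? (value p ∣? value d)) * F d) + (∑[ d ∈ [1⋯ N ] ] F (p *⁺ d))
    ≡⟨ ∑-+ [1⋯ N ] _ _ ⟨
  ∑[ d ∈ [1⋯ N ] ] (𝟙 (¬? (value p ∣? value d)) * F d + F (p *⁺ d))
    ≡⟨ ∑-cong [1⋯ N ] cancel ⟩
  ∑[ d ∈ [1⋯ N ] ] 0ℤ
    ≡⟨ ∑-zero [1⋯ N ] ⟩
  0ℤ
    ≡⟨ 𝟙-false (m ℕ.≟ 1) m≢1 ⟨
  𝟙 (m ℕ.≟ 1) ∎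
  where
  F : ℕ⁺ → ℤ
  F d = 𝟙 (value d ∣? m) * μ d

  -- The vanishing demanded by `∑-multiples`: a number above `N` exceeds `m` and cannot divide it.
  F≡0 : ∀ d → N < value d → F d ≡ 0ℤ
  F≡0 d N<d = cong (_* μ d) (𝟙-false (value d ∣? m) (>⇒∤ (ℕ.≤-<-trans m≤N N<d)))

  split : ∀ d → F d ≡ 𝟙 (¬? (value p ∣? value d)) * F d + 𝟙 (value p ∣? value d) * F d
  split d with value p ∣? value d
  ... | yes _ = sym (trans (ℤ.+-identityˡ _) (ℤ.*-identityˡ _))
  ... | no  _ = sym (trans (ℤ.+-identityʳ _) (ℤ.*-identityˡ _))

  cancel : ∀ d → 𝟙 (¬? (value p ∣? value d)) * F d + F (p *⁺ d) ≡ 0ℤ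
  cancel d with value p ∣? value d
  ... | yes p∣d = begin
    0ℤ + F (p *⁺ d)                       ≡⟨ ℤ.+-identityˡ _ ⟩
    𝟙 (value (p *⁺ d) ∣? m) * μ (p *⁺ d)  ≡⟨ cong (𝟙 (value (p *⁺ d) ∣? m) *_) (μ-prime-*-∣ p d p-prime p∣d) ⟩
    𝟙 (value (p *⁺ d) ∣? m) * 0ℤ          ≡⟨ ℤ.*-zeroʳ (𝟙 (value (p *⁺ d) ∣? m)) ⟩
    0ℤ                                    ∎
  ... | no p∤d = begin
    1ℤ * F d + F (p *⁺ d)  ≡⟨ cong₂ _+_ (ℤ.*-identityˡ (F d)) (cong₂ _*_ pd∣m⇔d∣m (μ-prime-*-∤ p d p-prime p∤d)) ⟩
    F d + 𝟙 (value d ∣? m) * - μ d  ≡⟨ cong (_+_ (F d)) (ℤ.neg-distribʳ-* (𝟙 (value d ∣? m)) (μ d)) ⟨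
    F d + - F d                     ≡⟨ ℤ.+-inverseʳ (F d) ⟩
    0ℤ                              ∎
    where
    from : value d ∣ m → value (p *⁺ d) ∣ m
    -- Now `m` is `k` times `d`, so `p` divides `k` or `d`; as it does not divide `d`, it can be
    -- absorbed from `k`.
    from (divides k refl) with euclidsLemma k (value d) p-prime p∣m
    ... | inj₁ p∣k = *-monoˡ-∣ (value d) p∣k
    ... | inj₂ p∣d = contradiction p∣d p∤d

    pd∣m⇔d∣m : 𝟙 (value (p *⁺ d) ∣? m) ≡ 𝟙 (value d ∣? m)
    pd∣m⇔d∣m = 𝟙-⇔ (value (p *⁺ d) ∣? m) (value d ∣? m) (m*n∣⇒n∣ (value p) (value d)) from

-- Integer division

[r+q*n]/n≡q : ∀ {r} q {n} .{{_ : NonZero n}} → r < n → (r ℕ.+ q ℕ.* n) / n ≡ q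
[r+q*n]/n≡q {r} q {n} r<n =
  trans (+-distrib-/-∣ʳ r (divides-refl q)) (cong₂ ℕ._+_ (m<n⇒m/n≡0 r<n) (m*n/n≡m q n))

-- Let `m` have quotient q and remainder r. If r + 1 < n, then `suc m` keeps the quotient q and has
-- the nonzero remainder r + 1; otherwise r + 1 = n and `suc m` is (q + 1) n.
suc-/ : ∀ m n .{{_ : NonZero n}} → + (suc m / n) ≡ + (m / n) + 𝟙 (n ∣? suc m)
suc-/ m n with ℕ.m≤n⇒m<n∨m≡n (m%n<n m n)
... | inj₁ 1+r<n = begin
  + (suc m / n)                 ≡⟨ cong +_ (trans (cong (λ k → suc k / n) (m≡m%n+[m/n]*n m n)) ([r+q*n]/n≡q (m / n) 1+r<n)) ⟩
  + (m / n)                     ≡⟨ ℤ.+-identityʳ _ ⟨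
  + (m / n) + 0ℤ                ≡⟨ cong (_+_ (+ (m / n))) (𝟙-false (n ∣? suc m) n∤1+m) ⟨
  + (m / n) + 𝟙 (n ∣? suc m)    ∎
  where
  n∤1+m : ¬ (n ∣ suc m)
  -- Subtracting the multiple q n would make `n` divide r + 1, which is positive and smaller than
  -- `n`.
  n∤1+m n∣1+m = >⇒∤ 1+r<n
    (∣m+n∣m⇒∣n (subst (n ∣_) 1+m≡qn+[1+r] n∣1+m) (n∣m*n (m / n)))
    where
    1+m≡qn+[1+r] : suc m ≡ m / n ℕ.* n ℕ.+ suc (m % n)
    1+m≡qn+[1+r] = trans (cong suc (m≡m%n+[m/n]*n m n)) (ℕ.+-comm (suc (m % n)) (m / n ℕ.* n))
... | inj₂ 1+r≡n = begin
  + (suc m / n)                 ≡⟨ cong (λ k → + (k / n)) 1+m≡[1+q]n ⟩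
  + (suc (m / n) ℕ.* n / n)     ≡⟨ cong +_ (m*n/n≡m (suc (m / n)) n) ⟩
  + suc (m / n)                 ≡⟨ cong +_ (ℕ.+-comm 1 (m / n)) ⟩
  + (m / n) + 1ℤ                ≡⟨ cong (_+_ (+ (m / n))) (𝟙-true (n ∣? suc m) (divides (suc (m / n)) 1+m≡[1+q]n)) ⟨
  + (m / n) + 𝟙 (n ∣? suc m)    ∎
  where
  1+m≡[1+q]n : suc m ≡ suc (m / n) ℕ.* n
  1+m≡[1+q]n = trans (cong suc (m≡m%n+[m/n]*n m n)) (cong (ℕ._+ m / n ℕ.* n) 1+r≡n)

infixl 7 _/⁺_

_/⁺_ : ℕ → ℕ⁺ → ℕ
m /⁺ mkℕ⁺ n = m / n

-- Induction on `M` with `N` fixed: by `suc-/`, passing from `M` to `suc M` adds the sum of `μ` over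
-- the divisors of `suc M`, which is 1 when `suc M` is 1 and 0 otherwise. The case of `M` zero is
-- included because `N /⁺ ∏ ns` can vanish.
∑-μ-/ : ∀ N M → M ≤ N → (∑[ n ∈ [1⋯ N ] ] μ n * + (M /⁺ n)) ≡ 𝟙 (1 ℕ.≤? M)
∑-μ-/ N zero    _   = trans
  (∑-cong [1⋯ N ] (λ { d@(mkℕ⁺ n) → trans (cong (λ k → μ d * + k) (0/n≡0 n)) (ℤ.*-zeroʳ (μ d)) }))
  (∑-zero [1⋯ N ])
∑-μ-/ N (suc M) M<N = begin
  ∑[ n ∈ [1⋯ N ] ] μ n * + (suc M /⁺ n)
    ≡⟨ ∑-cong [1⋯ N ] term ⟩
  ∑[ n ∈ [1⋯ N ] ] (μ n * + (M /⁺ n) + 𝟙 (value n ∣? suc M) * μ n)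
    ≡⟨ ∑-+ [1⋯ N ] _ _ ⟩
  (∑[ n ∈ [1⋯ N ] ] μ n * + (M /⁺ n)) + (∑[ n ∈ [1⋯ N ] ] 𝟙 (value n ∣? suc M) * μ n)
    ≡⟨ cong₂ _+_ (∑-μ-/ N M (ℕ.<⇒≤ M<N)) (∑-μ-divisors N (suc M) M<N) ⟩
  𝟙 (1 ℕ.≤? M) + 𝟙 (suc M ℕ.≟ 1)
    ≡⟨ last M ⟩
  𝟙 (1 ℕ.≤? suc M) ∎
  where
  term : ∀ n → μ n * + (suc M /⁺ n) ≡ μ n * + (M /⁺ n) + 𝟙 (value n ∣? suc M) * μ n
  term n⁺@(mkℕ⁺ n) = begin
    μ n⁺ * + (suc M / n)                              ≡⟨ cong (μ n⁺ *_) (suc-/ M n) ⟩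
    μ n⁺ * (+ (M / n) + 𝟙 (n ∣? suc M))               ≡⟨ ℤ.*-distribˡ-+ (μ n⁺) (+ (M / n)) (𝟙 (n ∣? suc M)) ⟩
    μ n⁺ * + (M / n) + μ n⁺ * 𝟙 (n ∣? suc M)          ≡⟨ cong (_+_ (μ n⁺ * + (M / n))) (ℤ.*-comm (μ n⁺) (𝟙 (n ∣? suc M))) ⟩
    μ n⁺ * + (M / n) + 𝟙 (n ∣? suc M) * μ n⁺          ∎

  -- The unit comes from the divisor sum when `M` is zero and from the induction hypothesis
  -- otherwise.
  last : ∀ M → 𝟙 (1 ℕ.≤? M) + 𝟙 (suc M ℕ.≟ 1) ≡ 𝟙 (1 ℕ.≤? suc M)
  last zero    = refl
  last (suc M) = refl

-- Tuples

-- The `NonZero` field is irrelevant, so two elements can differ only in their values.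
value-injective : ∀ {m n} → value m ≡ value n → m ≡ n
value-injective {mkℕ⁺ _} {mkℕ⁺ _} refl = refl

*⁺-comm : ∀ m n → m *⁺ n ≡ n *⁺ m
*⁺-comm m n = value-injective (ℕ.*-comm (value m) (value n))

*⁺-leftComm : ∀ l m n → l *⁺ (m *⁺ n) ≡ m *⁺ (l *⁺ n)
*⁺-leftComm l m n = value-injective (x∙yz≈y∙xz ℕ.*-commutativeSemigroup (value l) (value m) (value n))

-- Symmetry of the weighted sums over tuples

module _ (h : ℕ⁺ → ℤ) (xs : List ℕ⁺) where

  private
    -- In `S` every entry of a tuple of length `k` carries a weight; in `T` only the head of a tuple
    -- of length `k + 1` does. Since `f` sees only the product, the position of a weighted entry is
    -- immaterial.
    S T : ℕ → (ℕ⁺ → ℤ) → ℤ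
    S k f = ∑[ ns ∈ tuples k xs ] (∑[ n ∈ toList ns ] h n) * f (∏ ns)
    T k f = ∑[ m ∈ xs ] (∑[ ns ∈ tuples k xs ] h m * f (m *⁺ ∏ ns))

    -- The weight splits into that of the head and that of the tail; for the tail, the head `m` is
    -- absorbed into the function.
    S-suc : ∀ k f → S (suc k) f ≡ T k f + (∑[ m ∈ xs ] S k (λ d → f (m *⁺ d)))
    S-suc k f = begin
      S (suc k) f
        ≡⟨ ∑-tuples k xs _ ⟩
      ∑[ m ∈ xs ] (∑[ ns ∈ tuples k xs ] (h m + (∑[ n ∈ toList ns ] h n)) * f (m *⁺ ∏ ns))
        ≡⟨ ∑-cong xs (λ m → trans
             (∑-cong (tuples k xs) (λ ns → ℤ.*-distribʳ-+ (f (m *⁺ ∏ ns)) (h m) (∑ (toList ns) h)))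
             (∑-+ (tuples k xs) _ _)) ⟩
      ∑[ m ∈ xs ] ((∑[ ns ∈ tuples k xs ] h m * f (m *⁺ ∏ ns)) + S k (λ d → f (m *⁺ d)))
        ≡⟨ ∑-+ xs _ _ ⟩
      T k f + (∑[ m ∈ xs ] S k (λ d → f (m *⁺ d))) ∎

    -- Exchanging the first two entries brings the weighted one to the front without changing the
    -- product.
    T-suc : ∀ k f → (∑[ m ∈ xs ] T k (λ d → f (m *⁺ d))) ≡ T (suc k) f
    T-suc k f = begin
      ∑[ m ∈ xs ] (∑[ n ∈ xs ] (∑[ ns ∈ tuples k xs ] h n * f (m *⁺ (n *⁺ ∏ ns))))
        ≡⟨ ∑-swap xs xs _ ⟩
      ∑[ n ∈ xs ] (∑[ m ∈ xs ] (∑[ ns ∈ tuples k xs ] h n * f (m *⁺ (n *⁺ ∏ ns))))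
        ≡⟨ ∑-cong xs (λ n → ∑-cong xs (λ m → ∑-cong (tuples k xs) (λ ns →
             cong (λ d → h n * f d) (*⁺-leftComm m n (∏ ns))))) ⟩
      ∑[ n ∈ xs ] (∑[ m ∈ xs ] (∑[ ns ∈ tuples k xs ] h n * f (n *⁺ (m *⁺ ∏ ns))))
        ≡⟨ ∑-cong xs (λ n → ∑-tuples k xs _) ⟨
      T (suc k) f ∎

  -- Induction on `k` for all `f` at once: the head contributes one copy of `T`, and the tail
  -- contributes `k` more after `T-suc` has moved its weighted entry to the front.
  ∑-tuples-symmetric : ∀ k f →
    (∑[ ns ∈ tuples (suc k) xs ] (∑[ n ∈ toList ns ] h n) * f (∏ ns)) ≡
    + suc k * (∑[ m ∈ xs ] (∑[ ns ∈ tuples k xs ] h m * f (m *⁺ ∏ ns)))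
  ∑-tuples-symmetric zero    f = begin
    S 1 f                    ≡⟨ S-suc 0 f ⟩
    T 0 f + (∑[ m ∈ xs ] 0ℤ) ≡⟨ cong (_+_ (T 0 f)) (∑-zero xs) ⟩
    T 0 f + 0ℤ               ≡⟨ ℤ.+-identityʳ _ ⟩
    T 0 f                    ≡⟨ ℤ.*-identityˡ _ ⟨
    1ℤ * T 0 f               ∎
  ∑-tuples-symmetric (suc k) f = begin
    S (2 ℕ.+ k) f
      ≡⟨ S-suc (suc k) f ⟩
    T (suc k) f + (∑[ m ∈ xs ] S (suc k) (λ d → f (m *⁺ d)))
      ≡⟨ cong (_+_ (T (suc k) f)) (∑-cong xs (λ m → ∑-tuples-symmetric k (λ d → f (m *⁺ d)))) ⟩
    T (suc k) f + (∑[ m ∈ xs ] + suc k * T k (λ d → f (m *⁺ d)))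
      ≡⟨ cong (_+_ (T (suc k) f)) (∑-*ˡ xs (+ suc k) _) ⟩
    T (suc k) f + + suc k * (∑[ m ∈ xs ] T k (λ d → f (m *⁺ d)))
      ≡⟨ cong (λ t → T (suc k) f + + suc k * t) (T-suc k f) ⟩
    T (suc k) f + + suc k * T (suc k) f
      ≡⟨ ℤ.suc-* (+ suc k) (T (suc k) f) ⟨
    + suc (suc k) * T (suc k) f ∎

-- The weighted entry `m` is divided out last, so that `∑-μ-/` applies with `N /⁺ n` in the role of
-- `M`.
/⁺-*⁺ : ∀ N m n → N /⁺ (m *⁺ n) ≡ N /⁺ n /⁺ m
/⁺-*⁺ N m@(mkℕ⁺ m′) n@(mkℕ⁺ n′) = trans (cong (N /⁺_) (*⁺-comm m n)) (sym (m/n/o≡m/[n*o] N n′ m′ {{_}} {{_}} {{_}}))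

𝟙-1≤/⁺ : ∀ N d → 𝟙 (1 ℕ.≤? N /⁺ d) ≡ 𝟙 (value d ℕ.≤? N)
𝟙-1≤/⁺ N (mkℕ⁺ d) = 𝟙-⇔ (1 ℕ.≤? N / d) (d ℕ.≤? N) (m/n≢0⇒n≤m ∘ ℕ.>⇒≢) m≥n⇒m/n>0

-- Counting tuples by their product, and the identity for a natural number

-- `τ k n` searches a box that depends on `n`. Enlarging every box to `[1⋯ N ]` lets the sums be
-- exchanged; each tuple is then met once, at `n` equal to its product, provided that this is at
-- most `N`.
∑-τ : ∀ k N → (∑[ n ∈ [1⋯ N ] ] + τ k n) ≡ (∑[ ds ∈ tuples k [1⋯ N ] ] 𝟙 (value (∏ ds) ℕ.≤? N))
∑-τ k N = begin
  ∑[ n ∈ [1⋯ N ] ] + τ k n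
    ≡⟨ ∑-cong [1⋯ N ] (λ n → ∑-filter _ (tuples k [1⋯ value n ])) ⟩
  ∑[ n ∈ [1⋯ N ] ] (∑[ ds ∈ tuples k [1⋯ value n ] ] 𝟙 (value (∏ ds) ℕ.≟ value n))
    ≡⟨ ∑-cong-∈ [1⋯ N ] (λ {n} n∈ → sym (∑-tuples-truncate k (∈[1⋯]⇒≤ N n∈) (λ d → 𝟙 (value d ℕ.≟ value n))
         (λ d n<d → 𝟙-false (value d ℕ.≟ value n) (ℕ.>⇒≢ n<d)))) ⟩
  ∑[ n ∈ [1⋯ N ] ] (∑[ ds ∈ tuples k [1⋯ N ] ] 𝟙 (value (∏ ds) ℕ.≟ value n))
    ≡⟨ ∑-swap [1⋯ N ] (tuples k [1⋯ N ]) _ ⟩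
  ∑[ ds ∈ tuples k [1⋯ N ] ] (∑[ n ∈ [1⋯ N ] ] 𝟙 (value (∏ ds) ℕ.≟ value n))
    ≡⟨ ∑-cong (tuples k [1⋯ N ]) (λ ds → ∑-𝟙≡ N (∏ ds)) ⟩
  ∑[ ds ∈ tuples k [1⋯ N ] ] 𝟙 (value (∏ ds) ℕ.≤? N) ∎

-- With the other `k` entries fixed, the sum over the weighted entry `m` is `∑-μ-/` at `N /⁺ ∏ ns`,
-- hence the indicator that `∏ ns` is at most `N`; `∑-τ` counts the tuples that survive.
∑-μ-tuples : ∀ k N →
  (∑[ ns ∈ tuples (suc k) [1⋯ N ] ] (∑[ n ∈ toList ns ] μ n) * + (N /⁺ ∏ ns)) ≡
  + suc k * (∑[ n ∈ [1⋯ N ] ] + τ k n)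
∑-μ-tuples k N = trans (∑-tuples-symmetric μ [1⋯ N ] k (λ d → + (N /⁺ d))) (cong (+ suc k *_) (begin
  ∑[ m ∈ [1⋯ N ] ] (∑[ ns ∈ tuples k [1⋯ N ] ] μ m * + (N /⁺ (m *⁺ ∏ ns)))
    ≡⟨ ∑-swap [1⋯ N ] (tuples k [1⋯ N ]) _ ⟩
  ∑[ ns ∈ tuples k [1⋯ N ] ] (∑[ m ∈ [1⋯ N ] ] μ m * + (N /⁺ (m *⁺ ∏ ns)))
    ≡⟨ ∑-cong (tuples k [1⋯ N ]) (λ ns → trans
         (∑-cong [1⋯ N ] (λ m → cong (λ q → μ m * + q) (/⁺-*⁺ N m (∏ ns))))
         (∑-μ-/ N (N /⁺ ∏ ns) (/⁺-≤ N (∏ ns)))) ⟩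
  ∑[ ns ∈ tuples k [1⋯ N ] ] 𝟙 (1 ℕ.≤? N /⁺ ∏ ns)
    ≡⟨ ∑-cong (tuples k [1⋯ N ]) (λ ns → 𝟙-1≤/⁺ N (∏ ns)) ⟩
  ∑[ ns ∈ tuples k [1⋯ N ] ] 𝟙 (value (∏ ns) ℕ.≤? N)
    ≡⟨ ∑-τ k N ⟨
  ∑[ n ∈ [1⋯ N ] ] + τ k n ∎))
  where
  /⁺-≤ : ∀ N d → N /⁺ d ≤ N
  /⁺-≤ N (mkℕ⁺ d) = m/n≤m N d

-- Integer parts

fromℤ-mono-≤ : ∀ {m n} → m ℤ.≤ n → fromℤ m ℚ.≤ fromℤ n
fromℤ-mono-≤ m≤n = *≤* (ℤ.*-monoʳ-≤-nonNeg 1ℤ m≤n)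

fromℤ-cancel-< : ∀ {m n} → fromℤ m ℚ.< fromℤ n → m ℤ.< n
fromℤ-cancel-< {m} {n} (*<* m<n) = subst₂ ℤ._<_ (ℤ.*-identityʳ m) (ℤ.*-identityʳ n) m<n

-- The left side unfolds to the normalised fraction `m * n` over 1.
fromℤ-* : ∀ m n → fromℤ m ℚ.* fromℤ n ≡ fromℤ (m * n)
fromℤ-* m n = ℚ.↥p/↧p≡p (fromℤ (m * n))

-- From m ≤ x < n + 1 follows m ≤ n, and the roles of the two floors can be exchanged.
IsFloor-unique : ∀ x {m n} → IsFloor x m → IsFloor x n → m ≡ n
IsFloor-unique x ⌊x⌋≡m ⌊x⌋≡n = ℤ.≤-antisym (lower≤ ⌊x⌋≡m ⌊x⌋≡n) (lower≤ ⌊x⌋≡n ⌊x⌋≡m)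
  where
  lower≤ : ∀ {m n} → IsFloor x m → IsFloor x n → m ℤ.≤ n
  lower≤ {m} {n} (m≤x , _) (_ , q , x<q , q<n+1) = subst (m ℤ.≤_) pred[n+1]≡n
    (ℤ.i<j⇒i≤pred[j] (fromℤ-cancel-< (ℚ.≤-<-trans m≤q q<n+1)))
    where
    m≤q : fromℤ m ℚ.≤ q
    -- If `q` were below `m`, it would lie in both cuts of `x`.
    m≤q = ℚ.≮⇒≥ (λ q<m → ℝ.disjoint x (m≤x q q<m) x<q)

    pred[n+1]≡n : ℤ.pred (n + 1ℤ) ≡ n
    pred[n+1]≡n = trans (cong ℤ.pred (ℤ.+-comm n 1ℤ)) (ℤ.pred-suc n)

-- With k the quotient of `N` by `d`, k d ≤ N ≤ x < N + 1 ≤ (k + 1) d, and a cut of `x ÷ d` at p is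
-- by definition the cut of `x` at p d.
IsFloor-÷ : ∀ x d {N} → IsFloor x (+ N) → IsFloor (x ÷ d) (+ (N /⁺ d))
IsFloor-÷ x d⁺@(mkℕ⁺ d@(suc _)) {N} (N≤x , q , x<q , q<N+1) = lower , upper
  where
  D = fromℤ (+ d)
  k = N / d

  lower : fromInt (+ k) ≤ᴿ x ÷ d⁺
  lower p p<k = N≤x (p ℚ.* D) (ℚ.<-≤-trans (ℚ.*-monoˡ-<-pos D p<k)
    (subst (ℚ._≤ fromℤ (+ N)) (sym (fromℤ-* (+ k) (+ d)))
      (fromℤ-mono-≤ (subst (ℤ._≤ + N) (ℤ.pos-* k d) (ℤ.+≤+ (m/n*n≤m N d))))))

  -- This is the bound `N % d < d` on the remainder with k d added to both sides.
  N+1≤[k+1]d : N ℕ.+ 1 ≤ (k ℕ.+ 1) ℕ.* d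
  N+1≤[k+1]d = subst₂ _≤_
    (trans (cong suc (sym (m≡m%n+[m/n]*n N d))) (ℕ.+-comm 1 N))
    (cong (ℕ._* d) (ℕ.+-comm 1 k))
    (ℕ.+-monoˡ-≤ (k ℕ.* d) (m%n<n N d))

  q<[k+1]D : q ℚ.< fromℤ (+ k + 1ℤ) ℚ.* D
  q<[k+1]D = ℚ.<-≤-trans q<N+1 (subst (fromℤ (+ N + 1ℤ) ℚ.≤_) (sym (fromℤ-* (+ k + 1ℤ) (+ d)))
    (fromℤ-mono-≤ (subst (+ N + 1ℤ ℤ.≤_) (ℤ.pos-* (k ℕ.+ 1) d) (ℤ.+≤+ N+1≤[k+1]d))))

  upper : x ÷ d⁺ <ᴿ fromInt (+ k + 1ℤ)
  -- The relation `<ᴿ` asks for a rational strictly below k + 1; openness of the upper cut supplies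
  -- it.
  upper with p , p<k+1 , x÷d<p ← ℝ.U-open (x ÷ d⁺) (ℝ.U-upper x q<[k+1]D x<q) = p , x÷d<p , p<k+1

floor-÷ : ∀ (em : ExcludedMiddle 0ℓ) x d {N} → IsFloor x (+ N) → floor em (x ÷ d) ≡ + (N /⁺ d)
floor-÷ em x d ⌊x⌋≡N = IsFloor-unique (x ÷ d) (floor-isFloor em (x ÷ d)) (IsFloor-÷ x d ⌊x⌋≡N)

theorem1p6 : (em : ExcludedMiddle 0ℓ) (r : ℕ) → 2 ≤ r → (x : ℝ) → fromPos 1⁺ ≤ᴿ x →
    (∑[ ns ∈ tuples r (positives≤ em x) ] ((∑[ n ∈ toList ns ] μ n) * floor em (x ÷ ∏ ns)))
    ≡ + r * (∑[ n ∈ positives≤ em x ] (+ τ (r ∸ 1) n))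
theorem1p6 em (suc k) _ x _ = at (floor em x) (floor-isFloor em x)
  where
  -- The floor is abstracted to an integer `N`, so that matching on its sign makes the range of
  -- summation compute.
  at : ∀ N → IsFloor x N →
    (∑[ ns ∈ tuples (suc k) [1⋯ N ]ℤ ] ((∑[ n ∈ toList ns ] μ n) * floor em (x ÷ ∏ ns)))
    ≡ + suc k * (∑[ n ∈ [1⋯ N ]ℤ ] (+ τ k n))
  -- The range is empty, so there are no tuples of positive length and both sums are zero.
  at -[1+ _ ] _      = sym (ℤ.*-zeroʳ (+ suc k))
  at (+ N)    ⌊x⌋≡N = trans
    (∑-cong (tuples (suc k) [1⋯ N ]) (λ ns → cong (∑ (toList ns) μ *_) (floor-÷ em x (∏ ns) ⌊x⌋≡N)))
    (∑-μ-tuples k N)
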